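{- Any non-migratory non-clairvoyant algorithm for minimizing the total completion time of $n$ jobs on related machines (preemption allowed, all jobs released at time $0$), $Q\mid\mathrm{pmtn}\mid\sum C_j$, has a competitive ratio of at least $\Omega(\sqrt{n})$.
   Context: Related machines: there are $m$ machines with speeds $s_1,\dots,s_m$ and $n$ jobs, all available at time $0$, with processing requirements $p_j$; a job run on machine $i$ is processed at rate $s_i$. At any time each job can run on at most one machine and each machine can run at most one job; jobs may be preempted and resumed later. The completion time $C_j$ is the first time at which job $j$ has received $p_j$ units of processing; the objective is $\sum_jC_j$. An algorithm is non-migratory if each job is processed on only one machine throughout. It is non-clairvoyant if it learns $p_j$ only when job $j$ completes, i.e. its decisions at time $t$ depend only on the machine speeds and on which jobs have completed up to time $t$ (and when). The competitive ratio on instances with $n$ jobs is the worst-case ratio, over all such instances, between the algorithm's objective value and the optimal offline objective value. -}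

module Defs where

open import Algebra.Bundles using (CommutativeRing)
import Algebra.Definitions.RawMonoid as RawMonoidDefinitions
open import Data.Bool.Base using (if_then_else_)
open import Data.Fin.Base using (Fin)
import Data.Fin.Properties as Fin
open import Data.Maybe.Base using (Maybe; just)
import Data.Maybe.Properties as Maybe
open import Data.Nat.Base using (ℕ; NonZero)
open import Data.Product.Base using (Σ; ∃; _×_; _,_)
open import Function.Bundles using (_⇔_)
open import Level using (0ℓ)
open import Relation.Binary.Core using (Rel)
open import Relation.Binary.PropositionalEquality.Core using (_≡_)
open import Relation.Binary.Structures using (IsTotalOrder)
open import Relation.Nullary.Decidable.Core using (does)
open import Relation.Nullary.Negation.Core using (¬_)

-- The real numbers, characterised (up to isomorphism, in classical
-- logic) as a Dedekind-complete ordered field.  Equality is a setoid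
-- equality, so that e.g. Cauchy sequences of rationals qualify.

record RealNumbers : Set₁ where
  field
    commutativeRing : CommutativeRing 0ℓ 0ℓ

  open CommutativeRing commutativeRing public

  infix 4 _≤_ _<_

  field
    _≤_          : Rel Carrier 0ℓ
    isTotalOrder : IsTotalOrder _≈_ _≤_

  UpperBound : (Carrier → Set) → Carrier → Set
  UpperBound P b = ∀ x → P x → x ≤ b

  LowerBound : (Carrier → Set) → Carrier → Set
  LowerBound P b = ∀ x → P x → b ≤ x

  IsSupremum : (Carrier → Set) → Carrier → Set
  IsSupremum P u = UpperBound P u × (∀ b → UpperBound P b → u ≤ b)

  IsInfimum : (Carrier → Set) → Carrier → Set
  IsInfimum P l = LowerBound P l × (∀ b → LowerBound P b → b ≤ l)

  field
    0≉1           : ¬ 0# ≈ 1#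
    inverse       : ∀ x → ¬ x ≈ 0# → ∃ λ y → x * y ≈ 1#
    +-monoˡ-≤     : ∀ z {x y} → x ≤ y → x + z ≤ y + z
    *-nonNegative : ∀ {x y} → 0# ≤ x → 0# ≤ y → 0# ≤ x * y
    complete      : ∀ (P : Carrier → Set) → ∃ P → ∃ (UpperBound P) →
                    ∃ (IsSupremum P)

  _<_ : Rel Carrier 0ℓ
  x < y = x ≤ y × ¬ x ≈ y

  private
    module Monoid = RawMonoidDefinitions +-rawMonoid

  sum : ∀ {n} → (Fin n → Carrier) → Carrier
  sum = Monoid.sum

  fromℕ : ℕ → Carrier
  fromℕ n = n Monoid.× 1#

  IsSqrt : Carrier → Carrier → Set
  IsSqrt x r = 0# ≤ r × r * r ≈ x

  -- Tagged partitions of [a , b] all of whose cells have length ≤ δ;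
  -- `cell x τ …` splits off the cell [a , x], tagged by τ.

  data Partition (δ : Carrier) : Carrier → Carrier → Set where
    end  : ∀ {a b} → a ≈ b → Partition δ a b
    cell : ∀ {a b} (x τ : Carrier) → a ≤ τ → τ ≤ x → x - a ≤ δ →
           Partition δ x b → Partition δ a b

  riemannSum : ∀ {δ a b} → (Carrier → Carrier) → Partition δ a b → Carrier
  riemannSum f (end _)                    = 0#
  riemannSum f (cell {a = a} x τ _ _ _ π) = f τ * (x - a) + riemannSum f π

  -- v is the Riemann integral of f over [a , b].

  IsIntegral : (Carrier → Carrier) → Carrier → Carrier → Carrier → Set
  IsIntegral f a b v =
    ∀ ε → 0# < ε → ∃ λ δ → 0# < δ ×
      (∀ (π : Partition δ a b) →
         riemannSum f π ≤ v + ε × v ≤ riemannSum f π + ε)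

module Scheduling (ℝ : RealNumbers) where
  open RealNumbers ℝ

  Time : Set
  Time = Carrier

  record Machines : Set where
    field
      m       : ℕ
      {{m≢0}} : NonZero m
      speed   : Fin m → Carrier
      speed>0 : ∀ i → 0# < speed i

  record Jobs (n : ℕ) : Set where
    field
      p   : Fin n → Carrier
      p>0 : ∀ j → 0# < p j

  -- Preemptive schedules, possibly migratory, completing all jobs.
  -- Preemption is unrestricted as long as the rate at which each job is
  -- processed is Riemann integrable; in particular, infinitely many
  -- preemptions in bounded time are not excluded.  Only times t ≥ 0 matter.

  record Schedule {n : ℕ} (M : Machines) (J : Jobs n) : Set where
    open Machines M
    open Jobs J
    field
      run      : Time → Fin m → Maybe (Fin n)
      run-cong : ∀ {t u} → t ≈ u → ∀ i → run t i ≡ run u i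
      oneMachinePerJob : ∀ t → 0# ≤ t → ∀ j i i′ →
        run t i ≡ just j → run t i′ ≡ just j → i ≡ i′

    rate : Fin n → Time → Carrier
    rate j t = sum λ i →
      if does (Maybe.≡-dec Fin._≟_ (run t i) (just j)) then speed i else 0#

    field
      work          : Fin n → Time → Carrier
      work-integral : ∀ j t → 0# ≤ t → IsIntegral (rate j) 0# t (work j t)

      C        : Fin n → Time
      C≥0      : ∀ j → 0# ≤ C j
      C-done   : ∀ j → p j ≤ work j (C j)
      C-first  : ∀ j t → 0# ≤ t → p j ≤ work j t → C j ≤ t
      run-stop : ∀ t → 0# ≤ t → ∀ i j → run t i ≡ just j → t ≤ C j

    totalCompletionTime : Carrier
    totalCompletionTime = sum C

  open Schedule

  IsOptimum : ∀ {n} → Machines → Jobs n → Carrier → Set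
  IsOptimum M J = IsInfimum λ v →
    Σ (Schedule M J) λ S → totalCompletionTime S ≈ v

  -- A (deterministic) algorithm is identified with the schedules it
  -- produces; that it works online is the content of `NonClairvoyant`.

  Algorithm : Set
  Algorithm = ∀ {n} (M : Machines) (J : Jobs n) → Schedule M J

  NonMigratory : Algorithm → Set
  NonMigratory A = ∀ {n} (M : Machines) (J : Jobs n) (j : Fin n) →
    ∀ t t′ i i′ → 0# ≤ t → 0# ≤ t′ →
    run (A M J) t i ≡ just j → run (A M J) t′ i′ ≡ just j → i ≡ i′

  SameCompletionsUpTo : ∀ {n M} {J J′ : Jobs n} →
    Time → Schedule M J → Schedule M J′ → Set
  SameCompletionsUpTo t S S′ = ∀ j u → u ≤ t → C S j ≈ u ⇔ C S′ j ≈ u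

  NonClairvoyant : Algorithm → Set
  NonClairvoyant A = ∀ {n} (M : Machines) (J J′ : Jobs n) t → 0# ≤ t →
    SameCompletionsUpTo t (A M J) (A M J′) →
    ∀ i → run (A M J) t i ≡ run (A M J′) t i

  -- q is the ratio of A's objective to the optimum on some n-job instance.

  IsRatio : Algorithm → ℕ → Carrier → Set
  IsRatio A n q =
    Σ Machines λ M → Σ (Jobs n) λ J → ∃ λ opt →
      IsOptimum M J opt × q * opt ≈ totalCompletionTime (A M J)

  -- The competitive ratio is the supremum of these ratios, which may be
  -- infinite; x is at most this supremum iff x is at most every upper bound.

  CompetitiveRatioAtLeast : Algorithm → ℕ → Carrier → Set
  CompetitiveRatioAtLeast A n x = ∀ b → UpperBound (IsRatio A n) b → x ≤ b

module Submission where

-- Take one fast machine of speed s = √n and n slow machines of speed 1, and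
-- run the algorithm on n unit jobs.  If some job j runs on a slow machine
-- before it completes, lengthen j to s n: the algorithm cannot notice this
-- before the original completion of j, so j stays on its slow machine and
-- costs at least s n, whereas running j on the fast machine and every other
-- job on a slow machine of its own costs less than 2 n.  Otherwise all jobs
-- run on the fast machine, where at least half of the work is still
-- outstanding at time n / (2 s); the cost is thus at least n² / (4 s), whereas
-- n slow machines in parallel achieve n.

-- The speed s balances the two cases: a long job stuck at speed 1 gives a ratio of at least s / 2,
-- a run confined to the fast machine one of at least n / (4 s), so s = √n makes both of order √n
-- and the second case dictates the constant 1/4. That the algorithm cannot notice the lengthening
-- is the delicate point. Non-clairvoyance equates the two runs at t only if the completions up to t
-- already coincide, and those depend on the runs before t. The runs may already differ at that very
-- instant, so work has to be compared by integrals of rates that are known to agree on a half-open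
-- interval only.

open import Defs
open import Algebra.Bundles using (CommutativeRing)
open import Axiom.ExcludedMiddle using (ExcludedMiddle)
open import Data.Bool.Base using (if_then_else_; true; false)
open import Data.Fin.Base using (Fin; zero; suc)
import Data.Fin.Properties as Fin
open import Data.Integer.Base as ℤ using (ℤ; +_; -[1+_])
import Data.Integer.Properties as ℤ
open import Data.Maybe.Base as Maybe using (Maybe; just; nothing)
import Data.Maybe.Properties as Maybe
open import Data.Nat.Base as ℕ using (ℕ; zero; suc) renaming (_≤_ to _≤ℕ_)
import Data.Nat.Properties as ℕ
open import Data.Product.Base using (∃; Σ; _×_; _,_; proj₁; proj₂)
import Data.Sign.Base as Sign
open import Data.Sum.Base using (_⊎_; inj₁; inj₂)
open import Data.Vec.Functional using (updateAt)
open import Data.Vec.Functional.Properties using (updateAt-updates; updateAt-minimal)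
open import Function.Base using (_∘_; const)
open import Function.Bundles using (mk⇔)
open import Level using (0ℓ)
open import Relation.Binary.Bundles using (TotalOrder)
open import Relation.Binary.PropositionalEquality.Core as ≡ using (_≡_; _≢_)
open import Relation.Nullary using (¬_; Dec; yes; no; does; contradiction)
open import Relation.Nullary.Decidable using (dec⇒maybe; does-⇔; dec-true; dec-false)

-- The ring solver needs coefficients with decidable equality, which ℝ lacks;
-- integer coefficients also make it cancel x - x.
module IntegerCoefficients (R : CommutativeRing 0ℓ 0ℓ) where
  open CommutativeRing R
  open import Algebra.Properties.Ring ring
    using (-‿distribˡ-*; -‿distribʳ-*; -0#≈0#; -‿+-comm; -‿involutive)
  open import Algebra.Properties.Semiring.Mult.TCOptimised semiring
    using (×-homo-+; ×1-homo-*; 1+×) renaming (_×_ to _×′_)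
  open import Algebra.Solver.Ring.AlmostCommutativeRing
    using (fromCommutativeRing; _-Raw-AlmostCommutative⟶_)
  open import Relation.Binary.Reasoning.Setoid setoid

  ⟦_⟧ : ℤ → Carrier
  ⟦ + n ⟧      = n ×′ 1#
  ⟦ -[1+ n ] ⟧ = - (suc n ×′ 1#)

  ⟦⊖⟧ : ∀ m n → ⟦ m ℤ.⊖ n ⟧ ≈ m ×′ 1# - n ×′ 1#
  ⟦⊖⟧ m       zero    = sym (trans (+-congˡ -0#≈0#) (+-identityʳ _))
  ⟦⊖⟧ zero    (suc n) = sym (+-identityˡ _)
  ⟦⊖⟧ (suc m) (suc n) = begin
    ⟦ suc m ℤ.⊖ suc n ⟧                      ≡⟨ ≡.cong ⟦_⟧ (ℤ.[1+m]⊖[1+n]≡m⊖n m n) ⟩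
    ⟦ m ℤ.⊖ n ⟧                              ≈⟨ ⟦⊖⟧ m n ⟩
    m′ - n′                                  ≈⟨ +-congʳ (+-identityʳ m′) ⟨
    m′ + 0# - n′                             ≈⟨ +-congʳ (+-congˡ (-‿inverseʳ 1#)) ⟨
    m′ + (1# - 1#) - n′                      ≈⟨ +-congʳ (+-assoc m′ 1# (- 1#)) ⟨
    m′ + 1# - 1# - n′                        ≈⟨ +-assoc _ _ _ ⟩
    m′ + 1# + (- 1# - n′)                    ≈⟨ +-cong (+-comm m′ 1#) (-‿+-comm 1# n′) ⟩
    1# + m′ - (1# + n′)                      ≈⟨ +-cong (1+× m 1#) (-‿cong (1+× n 1#)) ⟨
    suc m ×′ 1# - suc n ×′ 1#                ∎
    where m′ = m ×′ 1#
          n′ = n ×′ 1#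

  +-homo : ∀ i j → ⟦ i ℤ.+ j ⟧ ≈ ⟦ i ⟧ + ⟦ j ⟧
  +-homo (+ m)    (+ n)    = ×-homo-+ 1# m n
  +-homo (+ m)    -[1+ n ] = ⟦⊖⟧ m (suc n)
  +-homo -[1+ m ] (+ n)    = trans (⟦⊖⟧ n (suc m)) (+-comm _ _)
  +-homo -[1+ m ] -[1+ n ] = begin
    - (suc (suc (m ℕ.+ n)) ×′ 1#)       ≡⟨ ≡.cong (λ k → - (suc k ×′ 1#)) (≡.sym (ℕ.+-suc m n)) ⟩
    - ((suc m ℕ.+ suc n) ×′ 1#)         ≈⟨ -‿cong (×-homo-+ 1# (suc m) (suc n)) ⟩
    - (suc m ×′ 1# + suc n ×′ 1#)       ≈⟨ -‿+-comm _ _ ⟨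
    - (suc m ×′ 1#) - suc n ×′ 1#       ∎

  -- The counterpart in `R` of `ℤ._◃_`. Integer multiplication is defined through signs and absolute
  -- values, so `*-homo` splits into a law for signs and one for natural numbers.
  signed : Sign.Sign → Carrier → Carrier
  signed Sign.+ x = x
  signed Sign.- x = - x

  signed-cong : ∀ s {x y} → x ≈ y → signed s x ≈ signed s y
  signed-cong Sign.+ x≈y = x≈y
  signed-cong Sign.- x≈y = -‿cong x≈y

  ⟦◃⟧ : ∀ s n → ⟦ s ℤ.◃ n ⟧ ≈ signed s (n ×′ 1#)
  ⟦◃⟧ Sign.+ zero    = refl
  ⟦◃⟧ Sign.- zero    = sym -0#≈0#
  ⟦◃⟧ Sign.+ (suc n) = refl
  ⟦◃⟧ Sign.- (suc n) = refl

  ⟦⟧-signed : ∀ i → ⟦ i ⟧ ≡ signed (ℤ.sign i) (ℤ.∣ i ∣ ×′ 1#)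
  ⟦⟧-signed (+ n)    = ≡.refl
  ⟦⟧-signed -[1+ n ] = ≡.refl

  signed-* : ∀ s t x y → signed (s Sign.* t) (x * y) ≈ signed s x * signed t y
  signed-* Sign.+ Sign.+ x y = refl
  signed-* Sign.+ Sign.- x y = -‿distribʳ-* x y
  signed-* Sign.- Sign.+ x y = -‿distribˡ-* x y
  signed-* Sign.- Sign.- x y = begin
    x * y           ≈⟨ -‿involutive _ ⟨
    - (- (x * y))   ≈⟨ -‿cong (-‿distribˡ-* x y) ⟩
    - (- x * y)     ≈⟨ -‿distribʳ-* (- x) y ⟩
    - x * - y       ∎

  *-homo : ∀ i j → ⟦ i ℤ.* j ⟧ ≈ ⟦ i ⟧ * ⟦ j ⟧
  *-homo i j = begin
    ⟦ i ℤ.* j ⟧                                          ≈⟨ ⟦◃⟧ s (∣i∣ ℕ.* ∣j∣) ⟩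
    signed s ((∣i∣ ℕ.* ∣j∣) ×′ 1#)                       ≈⟨ signed-cong s (×1-homo-* ∣i∣ ∣j∣) ⟩
    signed s (∣i∣ ×′ 1# * ∣j∣ ×′ 1#)                     ≈⟨ signed-* (ℤ.sign i) (ℤ.sign j) _ _ ⟩
    signed (ℤ.sign i) (∣i∣ ×′ 1#) * signed (ℤ.sign j) (∣j∣ ×′ 1#)
      ≡⟨ ≡.cong₂ _*_ (⟦⟧-signed i) (⟦⟧-signed j) ⟨
    ⟦ i ⟧ * ⟦ j ⟧                                        ∎
    where ∣i∣ = ℤ.∣ i ∣
          ∣j∣ = ℤ.∣ j ∣
          s   = ℤ.sign i Sign.* ℤ.sign j

  -‿homo : ∀ i → ⟦ ℤ.- i ⟧ ≈ - ⟦ i ⟧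
  -‿homo (+ zero)  = sym -0#≈0#
  -‿homo (+ suc n) = refl
  -‿homo -[1+ n ]  = sym (-‿involutive _)

  homomorphism : ℤ.+-*-rawRing -Raw-AlmostCommutative⟶ fromCommutativeRing R
  homomorphism = record
    { ⟦_⟧    = ⟦_⟧
    ; +-homo = +-homo
    ; *-homo = *-homo
    ; -‿homo = -‿homo
    ; 0-homo = refl
    ; 1-homo = refl
    }

  open import Algebra.Solver.Ring ℤ.+-*-rawRing (fromCommutativeRing R) homomorphism
    (λ i j → Maybe.map (reflexive ∘ ≡.cong ⟦_⟧) (dec⇒maybe (i ℤ.≟ j))) public
    using (solve; con; _:=_; _:+_; _:*_; _:-_)

-- Ordered field arithmetic, the Archimedean property and finite sums

module OrderedField (em : ExcludedMiddle 0ℓ) (ℝ : RealNumbers) where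
  open RealNumbers ℝ hiding (zero)
  open IntegerCoefficients commutativeRing using (solve; con; _:=_; _:+_; _:*_; _:-_)

  totalOrder : TotalOrder 0ℓ 0ℓ 0ℓ
  totalOrder = record { isTotalOrder = isTotalOrder }

  open TotalOrder totalOrder public
    using (poset; ≤-respˡ-≈; ≤-respʳ-≈)
    renaming (refl to ≤-refl; reflexive to ≤-reflexive; trans to ≤-trans; antisym to ≤-antisym;
              total to ≤-total)
  open import Relation.Binary.Properties.TotalOrder totalOrder public using (≰⇒>)
  open import Relation.Binary.Properties.Poset poset public using (<⇒≱)
  open import Relation.Binary.Reasoning.PartialOrder poset public
  open import Algebra.Construct.NaturalChoice.Min totalOrder public
    using (_⊓_; x⊓y≤x; x⊓y≤y; x≤y⇒x⊓y≈x; x≤y⇒y⊓x≈x)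
  open import Algebra.Properties.CommutativeMonoid.Sum +-commutativeMonoid public
    using (∑-distrib-+; sum-cong-≋; sum-replicate-zero)
  open import Algebra.Properties.Semiring.Sum semiring public using (*-distribˡ-sum)

  infix 4 _≤?_
  _≤?_ : ∀ x y → Dec (x ≤ y)
  x ≤? y = em

  -- The equation says d - c = b - a, so a rearrangement of an inequality is reduced to a ring
  -- identity, which the solver can check.
  ≤-transfer : ∀ {a b c d} → a ≤ b → a + d ≈ b + c → c ≤ d
  ≤-transfer {a} {b} {c} {d} a≤b eq = begin
    c              ≈⟨ solve 2 (λ a c → c := a :+ (c :- a)) refl a c ⟩
    a + (c - a)    ≤⟨ +-monoˡ-≤ (c - a) a≤b ⟩
    b + (c - a)    ≈⟨ solve 3 (λ a b c → b :+ (c :- a) := b :+ c :- a) refl a b c ⟩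
    b + c - a      ≈⟨ +-congʳ (sym eq) ⟩
    a + d - a      ≈⟨ solve 2 (λ a d → a :+ d :- a := d) refl a d ⟩
    d              ∎

  +-mono-≤ : ∀ {a b c d} → a ≤ b → c ≤ d → a + c ≤ b + d
  +-mono-≤ {a} {b} {c} {d} a≤b c≤d = begin
    a + c   ≤⟨ +-monoˡ-≤ c a≤b ⟩
    b + c   ≈⟨ +-comm b c ⟩
    c + b   ≤⟨ +-monoˡ-≤ b c≤d ⟩
    d + b   ≈⟨ +-comm d b ⟩
    b + d   ∎

  +-nonNegative : ∀ {x y} → 0# ≤ x → 0# ≤ y → 0# ≤ x + y
  +-nonNegative 0≤x 0≤y = ≤-respˡ-≈ (+-identityˡ 0#) (+-mono-≤ 0≤x 0≤y)

  x≤x+y : ∀ {x y} → 0# ≤ y → x ≤ x + y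
  x≤x+y {x} 0≤y = ≤-respˡ-≈ (+-identityʳ x) (+-mono-≤ ≤-refl 0≤y)

  x≤y⇒0≤y-x : ∀ {x y} → x ≤ y → 0# ≤ y - x
  x≤y⇒0≤y-x {x} {y} x≤y =
    ≤-transfer x≤y (solve 2 (λ x y → x :+ (y :- x) := y :+ con (+ 0)) refl x y)

  *-monoʳ-≤ : ∀ {z x y} → 0# ≤ z → x ≤ y → z * x ≤ z * y
  *-monoʳ-≤ {z} {x} {y} 0≤z x≤y = ≤-transfer (*-nonNegative 0≤z (x≤y⇒0≤y-x x≤y))
    (solve 3 (λ x y z → con (+ 0) :+ z :* y := z :* (y :- x) :+ z :* x) refl x y z)

  *-monoˡ-≤ : ∀ {z x y} → 0# ≤ z → x ≤ y → x * z ≤ y * z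
  *-monoˡ-≤ {z} {x} {y} 0≤z x≤y = begin
    x * z ≈⟨ *-comm x z ⟩
    z * x ≤⟨ *-monoʳ-≤ 0≤z x≤y ⟩
    z * y ≈⟨ *-comm z y ⟩
    y * z ∎

  0≤1 : 0# ≤ 1#
  0≤1 with ≤-total 0# 1#
  ... | inj₁ 0≤1 = 0≤1
  ... | inj₂ 1≤0 = ≤-respʳ-≈ (solve 0 ((con (+ 0) :- con (+ 1)) :* (con (+ 0) :- con (+ 1)) := con (+ 1)) refl)
    (*-nonNegative (x≤y⇒0≤y-x 1≤0) (x≤y⇒0≤y-x 1≤0))

  0<1 : 0# < 1#
  0<1 = 0≤1 , 0≉1

  0<x⇒x≉0 : ∀ {x} → 0# < x → ¬ x ≈ 0#
  0<x⇒x≉0 (_ , 0≉x) x≈0 = 0≉x (sym x≈0)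

  *-cancelˡ-≈ : ∀ {z x y} → 0# < z → z * x ≈ z * y → x ≈ y
  *-cancelˡ-≈ {z} {x} {y} 0<z eq with w , z*w≈1 ← inverse z (0<x⇒x≉0 0<z) = begin-equality
    x            ≈⟨ lemma x ⟨
    w * (z * x)  ≈⟨ *-congˡ eq ⟩
    w * (z * y)  ≈⟨ lemma y ⟩
    y            ∎
    where
    lemma : ∀ u → w * (z * u) ≈ u
    lemma u = begin-equality
      w * (z * u)  ≈⟨ solve 3 (λ w z u → w :* (z :* u) := z :* w :* u) refl w z u ⟩
      z * w * u    ≈⟨ *-congʳ z*w≈1 ⟩
      1# * u       ≈⟨ *-identityˡ u ⟩
      u            ∎

  *-cancelˡ-≤ : ∀ {z x y} → 0# < z → z * x ≤ z * y → x ≤ y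
  *-cancelˡ-≤ {z} {x} {y} 0<z zx≤zy with ≤-total x y
  ... | inj₁ x≤y = x≤y
  ... | inj₂ y≤x = ≤-reflexive (*-cancelˡ-≈ 0<z (≤-antisym zx≤zy (*-monoʳ-≤ (proj₁ 0<z) y≤x)))

  positiveInverse : ∀ {x} → 0# < x → ∃ λ y → 0# < y × x * y ≈ 1#
  positiveInverse {x} 0<x with y , xy≈1 ← inverse x (0<x⇒x≉0 0<x) =
    y , (*-cancelˡ-≤ 0<x 0≤xy , λ 0≈y → 0≉1 (begin-equality
      0#       ≈⟨ zeroʳ x ⟨
      x * 0#   ≈⟨ *-congˡ 0≈y ⟩
      x * y    ≈⟨ xy≈1 ⟩
      1#       ∎)) , xy≈1
    where
    0≤xy : x * 0# ≤ x * y
    0≤xy = begin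
      x * 0#  ≈⟨ zeroʳ x ⟩
      0#      ≤⟨ 0≤1 ⟩
      1#      ≈⟨ xy≈1 ⟨
      x * y   ∎

  *-positive : ∀ {x y} → 0# < x → 0# < y → 0# < x * y
  *-positive {x} {y} 0<x 0<y = *-nonNegative (proj₁ 0<x) (proj₁ 0<y) ,
    λ 0≈xy → proj₂ 0<y (*-cancelˡ-≈ 0<x (trans (zeroʳ x) 0≈xy))

  <-≤-trans : ∀ {x y z} → x < y → y ≤ z → x < z
  <-≤-trans x<y y≤z = begin-strict _ <⟨ x<y ⟩ _ ≤⟨ y≤z ⟩ _ ∎

  half : ∃ λ h → 0# < h × h + h ≈ 1#
  half with h , 0<h , eq ← positiveInverse {1# + 1#} (<-≤-trans 0<1 (x≤x+y 0≤1)) =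
    h , 0<h , trans (solve 1 (λ h → h :+ h := (con (+ 1) :+ con (+ 1)) :* h) refl h) eq

  halve : ∀ {x} → 0# < x → ∃ λ y → 0# < y × y + y ≈ x
  halve {x} 0<x with h , 0<h , eq ← half = x * h , *-positive 0<x 0<h , (begin-equality
    x * h + x * h   ≈⟨ distribˡ x h h ⟨
    x * (h + h)     ≈⟨ *-congˡ eq ⟩
    x * 1#          ≈⟨ *-identityʳ x ⟩
    x               ∎)

  x<y⇒0<y-x : ∀ {x y} → x < y → 0# < y - x
  x<y⇒0<y-x {x} {y} (x≤y , x≉y) = x≤y⇒0≤y-x x≤y , λ 0≈y-x → x≉y (begin-equality
    x             ≈⟨ +-identityˡ x ⟨
    0# + x        ≈⟨ +-congʳ 0≈y-x ⟩
    y - x + x     ≈⟨ solve 2 (λ x y → y :- x :+ x := y) refl x y ⟩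
    y             ∎)

  ≤-byApproximation : ∀ {x y} → (∀ ε → 0# < ε → x ≤ y + ε) → x ≤ y
  ≤-byApproximation {x} {y} approx with x ≤? y
  ... | yes x≤y = x≤y
  ... | no  x≰y = contradiction η≤0 (<⇒≱ 0<η)
    where
    halved = halve (x<y⇒0<y-x (≰⇒> x≰y))
    η      = proj₁ halved
    0<η    = proj₁ (proj₂ halved)

    η≤0 : η ≤ 0#
    η≤0 = ≤-transfer (approx η 0<η) (begin-equality
      x + 0#           ≈⟨ solve 2 (λ x y → x :+ con (+ 0) := y :+ (x :- y)) refl x y ⟩
      y + (x - y)      ≈⟨ +-congˡ (proj₂ (proj₂ halved)) ⟨
      y + (η + η)      ≈⟨ +-assoc y η η ⟨
      y + η + η        ∎)

  commonLowerBound : ∀ {x y} → 0# < x → 0# < y → ∃ λ z → 0# < z × z ≤ x × z ≤ y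
  commonLowerBound {x} {y} 0<x 0<y with ≤-total x y
  ... | inj₁ x≤y = x , 0<x , ≤-refl , x≤y
  ... | inj₂ y≤x = y , 0<y , y≤x , ≤-refl

  -- Otherwise the multiples of δ are bounded by x and have a supremum u. Each multiple has a
  -- successor below u, so u - δ is an upper bound too, which forces δ ≤ 0.
  archimedean : ∀ {δ} → 0# < δ → ∀ x → ∃ λ n → x ≤ fromℕ n * δ
  archimedean {δ} 0<δ x with em {∃ λ n → x ≤ fromℕ n * δ}
  ... | yes found = found
  ... | no  ¬found with u , upper , least ←
        complete (λ y → ∃ λ n → y ≈ fromℕ n * δ) (_ , 0 , refl)
          (x , λ { y (n , y≈nδ) → ≤-respˡ-≈ (sym y≈nδ) (proj₁ (≰⇒> (λ x≤nδ → ¬found (n , x≤nδ)))) })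
        = contradiction δ≤0 (<⇒≱ 0<δ)
    where
    δ≤0 : δ ≤ 0#
    δ≤0 = ≤-transfer (least (u - δ) λ { y (n , y≈nδ) → ≤-transfer (upper _ (suc n , refl)) (begin-equality
        (1# + fromℕ n) * δ + (u - δ)
          ≈⟨ solve 3 (λ n d u → (con (+ 1) :+ n) :* d :+ (u :- d) := u :+ n :* d) refl (fromℕ n) δ u ⟩
        u + fromℕ n * δ   ≈⟨ +-congˡ y≈nδ ⟨
        u + y             ∎) })
      (solve 2 (λ u d → u :+ con (+ 0) := u :- d :+ d) refl u δ)

  sum-mono-≤ : ∀ {n} {f g : Fin n → Carrier} → (∀ i → f i ≤ g i) → sum f ≤ sum g
  sum-mono-≤ {zero}  f≤g = ≤-refl
  sum-mono-≤ {suc n} f≤g = +-mono-≤ (f≤g zero) (sum-mono-≤ (f≤g ∘ suc))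

  sum-nonNegative : ∀ {n} {f : Fin n → Carrier} → (∀ i → 0# ≤ f i) → 0# ≤ sum f
  sum-nonNegative {zero}  0≤f = ≤-refl
  sum-nonNegative {suc n} 0≤f = +-nonNegative (0≤f zero) (sum-nonNegative (0≤f ∘ suc))

  term≤sum : ∀ {n} {f : Fin n → Carrier} → (∀ i → 0# ≤ f i) → ∀ k → f k ≤ sum f
  term≤sum 0≤f zero    = x≤x+y (sum-nonNegative (0≤f ∘ suc))
  term≤sum {f = f} 0≤f (suc k) = begin
    f (suc k)             ≤⟨ term≤sum (0≤f ∘ suc) k ⟩
    sum (f ∘ suc)         ≤⟨ x≤x+y (0≤f zero) ⟩
    sum (f ∘ suc) + f zero ≈⟨ +-comm _ _ ⟩
    f zero + sum (f ∘ suc) ∎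

  sum-zero : ∀ {n} {f : Fin n → Carrier} → (∀ i → f i ≈ 0#) → sum f ≈ 0#
  sum-zero {n} f≈0 = trans (sum-cong-≋ f≈0) (sum-replicate-zero n)

  sum-single : ∀ {n} {f : Fin n → Carrier} k → (∀ i → i ≢ k → f i ≈ 0#) → sum f ≈ f k
  sum-single {f = f} zero    f≈0 = trans (+-congˡ (sum-zero λ i → f≈0 (suc i) λ ())) (+-identityʳ _)
  sum-single {f = f} (suc k) f≈0 = trans
    (+-cong (f≈0 zero λ ()) (sum-single k λ i i≢k → f≈0 (suc i) λ { ≡.refl → i≢k ≡.refl }))
    (+-identityˡ _)

  sum-const : ∀ n x → sum {n} (const x) ≈ fromℕ n * x
  sum-const zero    x = sym (zeroˡ x)
  sum-const (suc n) x = begin-equality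
    x + sum {n} (const x)   ≈⟨ +-cong (sym (*-identityˡ x)) (sum-const n x) ⟩
    1# * x + fromℕ n * x    ≈⟨ distribʳ x 1# (fromℕ n) ⟨
    (1# + fromℕ n) * x      ∎

-- Riemann integrals: linearity, monotonicity, uniqueness

module Integration (em : ExcludedMiddle 0ℓ) (ℝ : RealNumbers) where
  open RealNumbers ℝ hiding (zero)
  open OrderedField em ℝ
  open IntegerCoefficients commutativeRing using (solve; con; _:=_; _:+_; _:*_; _:-_)

  Fun : Set
  Fun = Carrier → Carrier

  start≤end : ∀ {δ a b} → Partition δ a b → a ≤ b
  start≤end (end a≈b)              = ≤-reflexive a≈b
  start≤end (cell x τ a≤τ τ≤x _ π) = ≤-trans a≤τ (≤-trans τ≤x (start≤end π))

  refine : ∀ {δ δ′ a b} → δ ≤ δ′ → Partition δ a b → Partition δ′ a b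
  refine δ≤δ′ (end a≈b)                  = end a≈b
  refine δ≤δ′ (cell x τ a≤τ τ≤x x-a≤δ π) = cell x τ a≤τ τ≤x (≤-trans x-a≤δ δ≤δ′) (refine δ≤δ′ π)

  riemannSum-refine : ∀ {δ δ′ a b} f (δ≤δ′ : δ ≤ δ′) (π : Partition δ a b) →
    riemannSum f (refine δ≤δ′ π) ≡ riemannSum f π
  riemannSum-refine f δ≤δ′ (end _)                      = ≡.refl
  riemannSum-refine f δ≤δ′ (cell {a = a} x τ _ _ _ π) =
    ≡.cong (λ r → f τ * (x - a) + r) (riemannSum-refine f δ≤δ′ π)

  riemannSum-cong : ∀ {δ a b} {f g : Fun} → (∀ u → a ≤ u → f u ≈ g u) →
    (π : Partition δ a b) → riemannSum f π ≈ riemannSum g π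
  riemannSum-cong f≈g (end _)                  = refl
  riemannSum-cong f≈g (cell x τ a≤τ τ≤x _ π) = +-cong (*-congʳ (f≈g τ a≤τ))
    (riemannSum-cong (λ u x≤u → f≈g u (≤-trans a≤τ (≤-trans τ≤x x≤u))) π)

  riemannSum-const : ∀ {δ a b} r (π : Partition δ a b) → riemannSum (const r) π ≈ r * (b - a)
  riemannSum-const {a = a} {b} r (end a≈b) = begin-equality
    0#           ≈⟨ solve 2 (λ r b → con (+ 0) := r :* (b :- b)) refl r b ⟩
    r * (b - b)  ≈⟨ *-congˡ (+-congˡ (-‿cong a≈b)) ⟨
    r * (b - a)  ∎
  riemannSum-const {a = a} {b} r (cell x τ _ _ _ π) = begin-equality
    r * (x - a) + riemannSum (const r) π  ≈⟨ +-congˡ (riemannSum-const r π) ⟩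
    r * (x - a) + r * (b - x)
      ≈⟨ solve 4 (λ r a x b → r :* (x :- a) :+ r :* (b :- x) := r :* (b :- a)) refl r a x b ⟩
    r * (b - a)                           ∎

  riemannSum-+ : ∀ {δ a b} f g (π : Partition δ a b) →
    riemannSum (λ u → f u + g u) π ≈ riemannSum f π + riemannSum g π
  riemannSum-+ f g (end _) = sym (+-identityˡ 0#)
  riemannSum-+ f g (cell {a = a} x τ _ _ _ π) = trans (+-congˡ (riemannSum-+ f g π))
    (solve 5 (λ f g c F G → (f :+ g) :* c :+ (F :+ G) := f :* c :+ F :+ (g :* c :+ G))
      refl (f τ) (g τ) (x - a) (riemannSum f π) (riemannSum g π))

  -- Cells are tagged by their left endpoints, so that b is never sampled.
  leftPartition : ∀ {δ} → 0# < δ → ∀ {a b} → a ≤ b → Σ (Partition δ a b) λ π →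
    ∀ f g → (∀ u → a ≤ u → u < b → f u ≤ g u) → riemannSum f π ≤ riemannSum g π
  leftPartition {δ} 0<δ {a} {b} a≤b with n , b-a≤nδ ← archimedean 0<δ (b - a) = go n a a≤b b-a≤nδ
    where
    go : ∀ n a → a ≤ b → b - a ≤ fromℕ n * δ → Σ (Partition δ a b) λ π →
      ∀ f g → (∀ u → a ≤ u → u < b → f u ≤ g u) → riemannSum f π ≤ riemannSum g π
    go n a a≤b b-a≤nδ with em {a ≈ b}
    ... | yes a≈b = end a≈b , λ _ _ _ → ≤-refl
    go zero a a≤b b-a≤0 | no a≉b = contradiction
      (≤-antisym a≤b (≤-transfer b-a≤0
        (solve 3 (λ a b d → b :- a :+ a := con (+ 0) :* d :+ b) refl a b δ))) a≉b
    go (suc n) a a≤b b-a≤nδ | no a≉b with a + δ ≤? b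
    ... | no  a+δ≰b = cell b a ≤-refl a≤b
          (≤-transfer (proj₁ (≰⇒> a+δ≰b)) (solve 3 (λ a b d → b :+ d := a :+ d :+ (b :- a)) refl a b δ))
          (end refl) ,
          λ f g f≤g → +-monoˡ-≤ 0# (*-monoˡ-≤ (x≤y⇒0≤y-x a≤b) (f≤g a ≤-refl (a≤b , a≉b)))
    ... | yes a+δ≤b = cell (a + δ) a ≤-refl a≤a+δ
          (≤-reflexive (solve 2 (λ a d → a :+ d :- a := d) refl a δ)) (proj₁ rest) ,
          λ f g f≤g → +-mono-≤
            (*-monoˡ-≤ (x≤y⇒0≤y-x a≤a+δ) (f≤g a ≤-refl (a≤b , a≉b)))
            (proj₂ rest f g λ u a+δ≤u → f≤g u (≤-trans a≤a+δ a+δ≤u))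
      where
      a≤a+δ : a ≤ a + δ
      a≤a+δ = x≤x+y (proj₁ 0<δ)

      rest = go n (a + δ) a+δ≤b (≤-transfer b-a≤nδ
        (solve 4 (λ a b d n → b :- a :+ n :* d := (con (+ 1) :+ n) :* d :+ (b :- (a :+ d)))
          refl a b δ (fromℕ n)))

  -- Takes the place of additivity over adjacent intervals: continuing a partition up to c only adds
  -- nonnegative terms to its Riemann sum.
  extend : ∀ {δ a b c} → 0# < δ → b ≤ c → (π : Partition δ a b) → Σ (Partition δ a c) λ π′ →
    ∀ f → (∀ u → a ≤ u → 0# ≤ f u) → riemannSum f π ≤ riemannSum f π′
  extend {a = a} {c = c} 0<δ b≤c (end a≈b) with π′ , mono ← leftPartition 0<δ (≤-respˡ-≈ (sym a≈b) b≤c) =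
    π′ , λ f 0≤f → begin
      0#                        ≈⟨ zeroˡ (c - a) ⟨
      0# * (c - a)              ≈⟨ riemannSum-const 0# π′ ⟨
      riemannSum (const 0#) π′  ≤⟨ mono (const 0#) f (λ u a≤u _ → 0≤f u a≤u) ⟩
      riemannSum f π′           ∎
  extend 0<δ b≤c (cell x τ a≤τ τ≤x x-a≤δ π) with π′ , mono ← extend 0<δ b≤c π =
    cell x τ a≤τ τ≤x x-a≤δ π′ ,
    λ f 0≤f → +-mono-≤ ≤-refl (mono f λ u x≤u → 0≤f u (≤-trans a≤τ (≤-trans τ≤x x≤u)))

  integral-cong : ∀ {f g a b v} → (∀ u → a ≤ u → f u ≈ g u) →
    IsIntegral f a b v → IsIntegral g a b v
  integral-cong {f} {g} f≈g ∫f ε 0<ε with δ , 0<δ , close ← ∫f ε 0<ε =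
    δ , 0<δ , λ π → let Σf≈Σg = riemannSum-cong f≈g π in
      ≤-respˡ-≈ Σf≈Σg (proj₁ (close π)) , ≤-respʳ-≈ (+-congʳ Σf≈Σg) (proj₂ (close π))

  integral-const : ∀ r a b → IsIntegral (const r) a b (r * (b - a))
  -- Riemann sums of a constant are exact, so the mesh 1 is an arbitrary choice.
  integral-const r a b ε 0<ε = 1# , 0<1 , λ π →
    ≤-respˡ-≈ (sym (riemannSum-const r π)) (x≤x+y (proj₁ 0<ε)) ,
    ≤-respˡ-≈ (riemannSum-const r π) (x≤x+y (proj₁ 0<ε))

  private
    add-bounds : ∀ {x y ε η} z w → η + η ≈ ε → x ≤ z + η → y ≤ w + η → x + y ≤ z + w + ε
    add-bounds {x} {y} {ε} {η} z w η+η≈ε x≤z+η y≤w+η = begin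
      x + y               ≤⟨ +-mono-≤ x≤z+η y≤w+η ⟩
      z + η + (w + η)     ≈⟨ solve 3 (λ z w e → z :+ e :+ (w :+ e) := z :+ w :+ (e :+ e)) refl z w η ⟩
      z + w + (η + η)     ≈⟨ +-congˡ η+η≈ε ⟩
      z + w + ε           ∎

  Close : Fun → (a b v ε δ : Carrier) → Set
  Close f a b v ε δ = (π : Partition δ a b) → riemannSum f π ≤ v + ε × v ≤ riemannSum f π + ε

  close-refine : ∀ {f a b v ε δ δ′} → δ ≤ δ′ → Close f a b v ε δ′ → Close f a b v ε δ
  close-refine {f} {v = v} {ε} δ≤δ′ close π =
    ≡.subst (λ r → r ≤ v + ε × v ≤ r + ε) (riemannSum-refine f δ≤δ′ π) (close (refine δ≤δ′ π))

  integral-+ : ∀ {f g a b v w} → IsIntegral f a b v → IsIntegral g a b w →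
    IsIntegral (λ u → f u + g u) a b (v + w)
  integral-+ {f} {g} {a} {b} {v} {w} ∫f ∫g ε 0<ε =
    let η , 0<η , η+η≈ε      = halve 0<ε
        δ₁ , 0<δ₁ , close₁   = ∫f η 0<η
        δ₂ , 0<δ₂ , close₂   = ∫g η 0<η
        δ , 0<δ , δ≤δ₁ , δ≤δ₂ = commonLowerBound 0<δ₁ 0<δ₂
    in δ , 0<δ , λ π →
      let Σf≤ , v≤ = close-refine {f} δ≤δ₁ close₁ π
          Σg≤ , w≤ = close-refine {g} δ≤δ₂ close₂ π
      in ≤-respˡ-≈ (sym (riemannSum-+ f g π)) (add-bounds v w η+η≈ε Σf≤ Σg≤) ,
         ≤-respʳ-≈ (+-congʳ (sym (riemannSum-+ f g π)))
           (add-bounds (riemannSum f π) (riemannSum g π) η+η≈ε v≤ w≤)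

  integral-sum : ∀ {n a b} {f : Fin n → Fun} {v : Fin n → Carrier} →
    (∀ j → IsIntegral (f j) a b (v j)) → IsIntegral (λ u → sum λ j → f j u) a b (sum v)
  integral-sum {zero} {a} {b} ∫f ε 0<ε with δ , 0<δ , close ← integral-const 0# a b ε 0<ε =
    δ , 0<δ , λ π → ≤-respʳ-≈ (+-congʳ (zeroˡ (b - a))) (proj₁ (close π)) ,
      ≤-respˡ-≈ (zeroˡ (b - a)) (proj₂ (close π))
  integral-sum {suc n} {a} {b} {f} {v} ∫f =
    integral-+ {f zero} {λ u → sum λ j → f (suc j) u} {a} {b} {v zero} {sum (v ∘ suc)}
      (∫f zero) (integral-sum {n} {a} {b} {f ∘ suc} {v ∘ suc} (∫f ∘ suc))

  private
    compare : ∀ {x X Y y η ε} → η + η ≈ ε → x ≤ X + η → X ≤ Y → Y ≤ y + η → x ≤ y + ε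
    compare {x} {X} {Y} {y} {η} {ε} η+η≈ε x≤X+η X≤Y Y≤y+η = begin
      x            ≤⟨ x≤X+η ⟩
      X + η        ≤⟨ +-monoˡ-≤ η (≤-trans X≤Y Y≤y+η) ⟩
      y + η + η    ≈⟨ +-assoc y η η ⟩
      y + (η + η)  ≈⟨ +-congˡ η+η≈ε ⟩
      y + ε        ∎

  -- A single partition, fine enough for both integrals and tagged on the left, never samples b. The
  -- hypothesis can therefore stop short of b, as it must where two runs are known to agree only
  -- strictly before some time.
  integral-mono-≤ : ∀ {f g a b v w} → a ≤ b → (∀ u → a ≤ u → u < b → f u ≤ g u) →
    IsIntegral f a b v → IsIntegral g a b w → v ≤ w
  integral-mono-≤ {f} {g} a≤b f≤g ∫f ∫g = ≤-byApproximation λ ε 0<ε →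
    let η , 0<η , η+η≈ε      = halve 0<ε
        δ₁ , 0<δ₁ , close₁   = ∫f η 0<η
        δ₂ , 0<δ₂ , close₂   = ∫g η 0<η
        δ , 0<δ , δ≤δ₁ , δ≤δ₂ = commonLowerBound 0<δ₁ 0<δ₂
        π , mono             = leftPartition 0<δ a≤b
    in compare η+η≈ε (proj₂ (close-refine {f} δ≤δ₁ close₁ π)) (mono f g f≤g)
         (proj₁ (close-refine {g} δ≤δ₂ close₂ π))

  integral-unique : ∀ {f g a b v w} → a ≤ b → (∀ u → a ≤ u → u < b → f u ≈ g u) →
    IsIntegral f a b v → IsIntegral g a b w → v ≈ w
  integral-unique a≤b f≈g ∫f ∫g = ≤-antisym
    (integral-mono-≤ a≤b (λ u a≤u u<b → ≤-reflexive (f≈g u a≤u u<b)) ∫f ∫g)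
    (integral-mono-≤ a≤b (λ u a≤u u<b → ≤-reflexive (sym (f≈g u a≤u u<b))) ∫g ∫f)

  integral-extend-≤ : ∀ {f a b c v w} → a ≤ b → b ≤ c → (∀ u → a ≤ u → 0# ≤ f u) →
    IsIntegral f a b v → IsIntegral f a c w → v ≤ w
  integral-extend-≤ {f} a≤b b≤c 0≤f ∫b ∫c = ≤-byApproximation λ ε 0<ε →
    let η , 0<η , η+η≈ε      = halve 0<ε
        δ₁ , 0<δ₁ , close₁   = ∫b η 0<η
        δ₂ , 0<δ₂ , close₂   = ∫c η 0<η
        δ , 0<δ , δ≤δ₁ , δ≤δ₂ = commonLowerBound 0<δ₁ 0<δ₂
        π , _                = leftPartition 0<δ a≤b
        π′ , mono            = extend 0<δ b≤c π
    in compare η+η≈ε (proj₂ (close-refine {f} δ≤δ₁ close₁ π)) (mono f 0≤f)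
         (proj₁ (close-refine {f} δ≤δ₂ close₂ π′))

  -- The integral of a rate that drops to 0 after a deadline

  module Cutoff (s D : Carrier) (0<s : 0# < s) where
    -- The rate of a job that runs at speed s from time 0 until it completes at D.
    cutoff : Fun
    cutoff u = if does (u ≤? D) then s else 0#

    cutoff-before : ∀ {u} → u ≤ D → cutoff u ≡ s
    cutoff-before {u} u≤D rewrite dec-true (u ≤? D) u≤D = ≡.refl

    cutoff-after : ∀ {u} → D < u → cutoff u ≡ 0#
    cutoff-after {u} D<u rewrite dec-false (u ≤? D) (<⇒≱ D<u) = ≡.refl

    0≤cutoff : ∀ u → 0# ≤ cutoff u
    0≤cutoff u with does (u ≤? D)
    ... | true  = proj₁ 0<s
    ... | false = ≤-refl

    cutoff≤s : ∀ u → cutoff u ≤ s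
    cutoff≤s u with does (u ≤? D)
    ... | true  = ≤-refl
    ... | false = proj₁ 0<s

    riemannSum-after : ∀ {δ a b} → D < a → (π : Partition δ a b) → riemannSum cutoff π ≈ 0#
    riemannSum-after {a = a} {b} D<a π = begin-equality
      riemannSum cutoff π        ≈⟨ riemannSum-cong (λ u a≤u → reflexive (cutoff-after (<-≤-trans D<a a≤u))) π ⟩
      riemannSum (const 0#) π  ≈⟨ riemannSum-const 0# π ⟩
      0# * (b - a)             ≈⟨ zeroˡ (b - a) ⟩
      0#                       ∎

    riemannSum-before : ∀ {δ a b} → b ≤ D → (π : Partition δ a b) → riemannSum cutoff π ≈ s * (b - a)
    riemannSum-before {δ} b≤D (end a≈b) = riemannSum-const {δ} s (end a≈b)
    riemannSum-before {a = a} {b} b≤D (cell x τ a≤τ τ≤x _ π) = begin-equality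
      cutoff τ * (x - a) + riemannSum cutoff π  ≡⟨ ≡.cong (λ r → r * (x - a) + riemannSum cutoff π) (cutoff-before τ≤D) ⟩
      s * (x - a) + riemannSum cutoff π       ≈⟨ +-congˡ (riemannSum-before b≤D π) ⟩
      s * (x - a) + s * (b - x)
        ≈⟨ solve 4 (λ r a x b → r :* (x :- a) :+ r :* (b :- x) := r :* (b :- a)) refl s a x b ⟩
      s * (b - a)                           ∎
      where τ≤D = ≤-trans τ≤x (≤-trans (start≤end π) b≤D)

    -- Only the cell containing D contributes an error, of at most s δ.
    riemannSum-across : ∀ {δ a b} → 0# < δ → a ≤ D → D ≤ b → (π : Partition δ a b) →
      riemannSum cutoff π ≤ s * (D - a) + s * δ × s * (D - a) ≤ riemannSum cutoff π + s * δ
    riemannSum-across {δ} {a} {b} 0<δ a≤D D≤b (end a≈b) =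
      +-nonNegative (*-nonNegative (proj₁ 0<s) (x≤y⇒0≤y-x a≤D)) 0≤sδ , (begin
        s * (D - a)  ≤⟨ *-monoʳ-≤ (proj₁ 0<s) (+-monoˡ-≤ (- a) D≤b) ⟩
        s * (b - a)  ≈⟨ *-congˡ (+-congˡ (-‿cong a≈b)) ⟩
        s * (b - b)  ≈⟨ solve 2 (λ s b → s :* (b :- b) := con (+ 0)) refl s b ⟩
        0#           ≤⟨ x≤x+y 0≤sδ ⟩
        0# + s * δ   ∎)
      where 0≤sδ = *-nonNegative (proj₁ 0<s) (proj₁ 0<δ)
    riemannSum-across {δ} {a} {b} 0<δ a≤D D≤b (cell x τ a≤τ τ≤x x-a≤δ π) with x ≤? D
    ... | yes x≤D with upper , lower ← riemannSum-across 0<δ x≤D D≤b π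
                  rewrite cutoff-before (≤-trans τ≤x x≤D) =
      (begin
        s * (x - a) + riemannSum cutoff π           ≤⟨ +-mono-≤ ≤-refl upper ⟩
        s * (x - a) + (s * (D - x) + s * δ)
          ≈⟨ solve 5 (λ s a x D e → s :* (x :- a) :+ (s :* (D :- x) :+ e) := s :* (D :- a) :+ e)
               refl s a x D (s * δ) ⟩
        s * (D - a) + s * δ                       ∎) ,
      (begin
        s * (D - a)
          ≈⟨ solve 4 (λ s a x D → s :* (D :- a) := s :* (x :- a) :+ s :* (D :- x)) refl s a x D ⟩
        s * (x - a) + s * (D - x)                 ≤⟨ +-mono-≤ ≤-refl lower ⟩
        s * (x - a) + (riemannSum cutoff π + s * δ) ≈⟨ +-assoc _ _ _ ⟨
        s * (x - a) + riemannSum cutoff π + s * δ   ∎)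
    ... | no  x≰D =
      (begin
        cutoff τ * (x - a) + riemannSum cutoff π  ≈⟨ +-congˡ (riemannSum-after D<x π) ⟩
        cutoff τ * (x - a) + 0#                 ≈⟨ +-identityʳ _ ⟩
        cutoff τ * (x - a)                      ≤⟨ *-monoˡ-≤ 0≤x-a (cutoff≤s τ) ⟩
        s * (x - a)                           ≤⟨ *-monoʳ-≤ (proj₁ 0<s) x-a≤δ ⟩
        s * δ                                 ≤⟨ x≤x+y (*-nonNegative (proj₁ 0<s) (x≤y⇒0≤y-x a≤D)) ⟩
        s * δ + s * (D - a)                   ≈⟨ +-comm _ _ ⟩
        s * (D - a) + s * δ                   ∎) ,
      (begin
        s * (D - a)                                 ≤⟨ *-monoʳ-≤ (proj₁ 0<s) (+-monoˡ-≤ (- a) (proj₁ D<x)) ⟩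
        s * (x - a)                                 ≤⟨ *-monoʳ-≤ (proj₁ 0<s) x-a≤δ ⟩
        s * δ                                       ≤⟨ x≤x+y (*-nonNegative (0≤cutoff τ) 0≤x-a) ⟩
        s * δ + cutoff τ * (x - a)                    ≈⟨ +-comm _ _ ⟩
        cutoff τ * (x - a) + s * δ                    ≈⟨ +-congʳ (+-identityʳ _) ⟨
        cutoff τ * (x - a) + 0# + s * δ               ≈⟨ +-congʳ (+-congˡ (riemannSum-after D<x π)) ⟨
        cutoff τ * (x - a) + riemannSum cutoff π + s * δ ∎)
      where
      D<x   = ≰⇒> x≰D
      0≤x-a = x≤y⇒0≤y-x (≤-trans a≤τ τ≤x)

    integral-cutoff : ∀ {t} → 0# ≤ D → IsIntegral cutoff 0# t (s * (t ⊓ D))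
    integral-cutoff {t} 0≤D ε 0<ε with r , 0<r , sr≈1 ← positiveInverse 0<s =
      -- Here `r` is 1 / s, so the error s δ caused by the cell that contains D becomes ε.
      r * ε , 0<rε , bounds
      where
      0<rε : 0# < r * ε
      0<rε = *-positive 0<r 0<ε

      s[rε]≈ε : s * (r * ε) ≈ ε
      s[rε]≈ε = trans (sym (*-assoc s r ε)) (trans (*-congʳ sr≈1) (*-identityˡ ε))

      x-0≈x : ∀ x → x - 0# ≈ x
      x-0≈x x = solve 1 (λ x → x :- con (+ 0) := x) refl x

      bounds : (π : Partition (r * ε) 0# t) →
        riemannSum cutoff π ≤ s * (t ⊓ D) + ε × s * (t ⊓ D) ≤ riemannSum cutoff π + ε
      bounds π with ≤-total t D
      ... | inj₁ t≤D =
        let eq = trans (riemannSum-before t≤D π) (*-congˡ (x-0≈x t)) in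
        ≤-respˡ-≈ (sym eq) (x≤x+y (proj₁ 0<ε)) , ≤-respˡ-≈ eq (x≤x+y (proj₁ 0<ε))
      ... | inj₂ D≤t with upper , lower ← riemannSum-across 0<rε 0≤D D≤t π =
        ≤-respʳ-≈ (+-cong (*-congˡ (x-0≈x D)) s[rε]≈ε) upper ,
        ≤-respˡ-≈ (*-congˡ (x-0≈x D)) (≤-respʳ-≈ (+-congˡ s[rε]≈ε) lower)

-- Rates and work in a schedule

module Schedules (em : ExcludedMiddle 0ℓ) (ℝ : RealNumbers) where
  open RealNumbers ℝ hiding (zero)
  open OrderedField em ℝ
  open Integration em ℝ
  open IntegerCoefficients commutativeRing using (solve; con; _:=_; _:+_; _:*_; _:-_)
  open Scheduling ℝ
  open Machines using (m; speed; speed>0)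
  open Jobs using (p; p>0)
  open Schedule

  share : ∀ {n} → Maybe (Fin n) → Fin n → Carrier → Carrier
  share r j s = if does (Maybe.≡-dec Fin._≟_ r (just j)) then s else 0#

  share-hit : ∀ {n r} {j : Fin n} s → r ≡ just j → share r j s ≡ s
  share-hit {r = r} {j} s r≡j rewrite dec-true (Maybe.≡-dec Fin._≟_ r (just j)) r≡j = ≡.refl

  share-miss : ∀ {n r} {j : Fin n} s → r ≢ just j → share r j s ≡ 0#
  share-miss {r = r} {j} s r≢j rewrite dec-false (Maybe.≡-dec Fin._≟_ r (just j)) r≢j = ≡.refl

  0≤share : ∀ {n} r (j : Fin n) {s} → 0# ≤ s → 0# ≤ share r j s
  0≤share r j 0≤s with does (Maybe.≡-dec Fin._≟_ r (just j))
  ... | true  = 0≤s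
  ... | false = ≤-refl

  share≤ : ∀ {n} r (j : Fin n) {s} → 0# ≤ s → share r j s ≤ s
  share≤ r j 0≤s with does (Maybe.≡-dec Fin._≟_ r (just j))
  ... | true  = ≤-refl
  ... | false = 0≤s

  module _ {n : ℕ} (M : Machines) where
    private
      0≤speed : ∀ i → 0# ≤ speed M i
      0≤speed i = proj₁ (speed>0 M i)

    -- For `r = run S t` this unfolds to `rate S j t`. Abstracting from the schedule makes the
    -- lemmas available while a schedule is still under construction.
    rateOf : (Fin (m M) → Maybe (Fin n)) → Fin n → Carrier
    rateOf r j = sum λ i → share (r i) j (speed M i)

    rateOf-cong : ∀ {r r′} → (∀ i → r i ≡ r′ i) → ∀ j → rateOf r j ≈ rateOf r′ j
    rateOf-cong r≗r′ j = sum-cong-≋ λ i → reflexive (≡.cong (λ r → share r j (speed M i)) (r≗r′ i))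

    0≤rateOf : ∀ r j → 0# ≤ rateOf r j
    0≤rateOf r j = sum-nonNegative λ i → 0≤share (r i) j (0≤speed i)

    rateOf≤totalSpeed : ∀ r j → rateOf r j ≤ sum (speed M)
    rateOf≤totalSpeed r j = sum-mono-≤ λ i → share≤ (r i) j (0≤speed i)

    rateOf-idle : ∀ r j → (∀ i → r i ≢ just j) → rateOf r j ≈ 0#
    rateOf-idle r j idle = sum-zero λ i → reflexive (share-miss (speed M i) (idle i))

    rateOf-single : ∀ r j k → (∀ i → r i ≡ just j → i ≡ k) → rateOf r j ≈ share (r k) j (speed M k)
    rateOf-single r j k only-k = sum-single k λ i i≢k →
      reflexive (share-miss (speed M i) λ ri≡j → i≢k (only-k i ri≡j))

    rateOf≤speed : ∀ r j k → (∀ i → r i ≡ just j → i ≡ k) → rateOf r j ≤ speed M k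
    rateOf≤speed r j k only-k =
      ≤-respˡ-≈ (sym (rateOf-single r j k only-k)) (share≤ (r k) j (0≤speed k))

    -- Only machine k contributes, and it holds at most one job, so its speed is counted at most
    -- once in the sum over all jobs.
    totalRate≤speed : ∀ r k → (∀ j i → r i ≡ just j → i ≡ k) → sum (rateOf r) ≤ speed M k
    totalRate≤speed r k only-k = ≤-respˡ-≈
      (sum-cong-≋ λ j → sym (rateOf-single r j k (only-k j))) (shares≤ (r k))
      where
      shares≤ : ∀ q → sum (λ j → share q j (speed M k)) ≤ speed M k
      shares≤ nothing   = ≤-respˡ-≈ (sym (sum-zero {n} λ j → refl)) (0≤speed k)
      shares≤ (just j₀) = ≤-respˡ-≈
        (sym (sum-single j₀ λ j j≢j₀ → reflexive (share-miss {r = just j₀} {j} (speed M k) λ { ≡.refl → j≢j₀ ≡.refl })))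
        (share≤ (just j₀) j₀ (0≤speed k))

  module _ {n : ℕ} {M : Machines} {J : Jobs n} (S : Schedule M J) where
    work≤ : ∀ j {t} r → 0# ≤ t → (∀ u → 0# ≤ u → u < t → rate S j u ≤ r) → work S j t ≤ r * t
    work≤ j {t} r 0≤t rate≤r = ≤-respʳ-≈
      (*-congˡ (solve 1 (λ t → t :- con (+ 0) := t) refl t))
      (integral-mono-≤ 0≤t rate≤r (work-integral S j t 0≤t) (integral-const r 0# t))

    totalWork≤ : ∀ {t} r → 0# ≤ t → (∀ u → 0# ≤ u → u < t → sum (λ j → rate S j u) ≤ r) →
      sum (λ j → work S j t) ≤ r * t
    totalWork≤ {t} r 0≤t rate≤r = ≤-respʳ-≈
      (*-congˡ (solve 1 (λ t → t :- con (+ 0) := t) refl t))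
      (integral-mono-≤ 0≤t rate≤r
        (integral-sum {f = rate S} λ j → work-integral S j t 0≤t) (integral-const r 0# t))

    work-nonNegative : ∀ j {t} → 0# ≤ t → 0# ≤ work S j t
    work-nonNegative j {t} 0≤t = ≤-respˡ-≈ (zeroˡ (t - 0#))
      (integral-mono-≤ 0≤t (λ u _ _ → 0≤rateOf M (run S u) j)
        (integral-const 0# 0# t) (work-integral S j t 0≤t))

    completed : ∀ j {t} → C S j ≤ t → p J j ≤ work S j t
    completed j {t} C≤t = ≤-trans (C-done S j) (integral-extend-≤ (C≥0 S j) C≤t
      (λ u _ → 0≤rateOf M (run S u) j)
      (work-integral S j (C S j) (C≥0 S j)) (work-integral S j t (≤-trans (C≥0 S j) C≤t)))

    p≤speed*C : ∀ j r → (∀ u → 0# ≤ u → u < C S j → rate S j u ≤ r) → p J j ≤ r * C S j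
    p≤speed*C j r rate≤r = ≤-trans (C-done S j) (work≤ j r (C≥0 S j) rate≤r)

    -- A job idle on [0 , C) has rate 0 there and hence no work by C, although its size is positive.
    -- The strict bound u < C is what the comparison with a lengthened instance requires.
    runsBeforeCompletion : ∀ j → ∃ λ u → 0# ≤ u × u < C S j × ∃ λ i → run S u i ≡ just j
    runsBeforeCompletion j with em {∃ λ u → 0# ≤ u × u < C S j × ∃ λ i → run S u i ≡ just j}
    ... | yes found = found
    ... | no ¬found = contradiction
      (≤-respʳ-≈ (zeroˡ (C S j)) (p≤speed*C j 0# λ u 0≤u u<C →
        ≤-reflexive (rateOf-idle M (run S u) j λ i runs → ¬found (u , 0≤u , u<C , i , runs))))
      (<⇒≱ (p>0 J j))

  -- The optimum, and lower bounds on the competitive ratio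

  module _ {n : ℕ} (M : Machines) (J : Jobs n) (j : Fin n) where
    -- One bound ℓ for all schedules makes their infimum positive, so that the algorithm's cost can
    -- be divided by it.
    costLowerBound : ∃ λ ℓ → 0# < ℓ × ∀ (S : Schedule M J) → ℓ ≤ totalCompletionTime S
    costLowerBound =
      let r , 0<r , br≈1 = positiveInverse 0<b in
      r * p J j , *-positive 0<r (p>0 J j) , λ S → *-cancelˡ-≤ 0<b (begin
        b * (r * p J j)            ≈⟨ *-assoc b r (p J j) ⟨
        b * r * p J j              ≈⟨ *-congʳ br≈1 ⟩
        1# * p J j                 ≈⟨ *-identityˡ (p J j) ⟩
        p J j                      ≤⟨ p≤speed*C S j b (λ u _ _ →
                                        ≤-trans (rateOf≤totalSpeed M (run S u) j) (x≤x+y 0≤1)) ⟩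
        b * C S j                  ≤⟨ *-monoʳ-≤ (proj₁ 0<b) (term≤sum (C≥0 S) j) ⟩
        b * totalCompletionTime S  ∎)
      where
      b : Carrier
      -- The total speed bounds the rate of any job; the extra 1 makes positivity immediate.
      b = sum (speed M) + 1#

      0<b : 0# < b
      0<b = <-≤-trans 0<1 (≤-respʳ-≈ (+-comm 1# _) (x≤x+y (sum-nonNegative λ i → proj₁ (speed>0 M i))))

    Cost : Carrier → Set
    Cost v = Σ (Schedule M J) λ S → totalCompletionTime S ≈ v

    optimumExists : Schedule M J → ∃ λ opt → 0# < opt × IsOptimum M J opt
    optimumExists S =
      let ℓ , 0<ℓ , ℓ≤cost      = costLowerBound
          ℓ-bound : LowerBound Cost ℓ
          ℓ-bound               = λ { v (S′ , eq) → ≤-respʳ-≈ eq (ℓ≤cost S′) }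
          -- Completeness provides suprema, so the infimum of the costs is taken as the supremum of
          -- their lower bounds.
          opt , upper , least   = complete (LowerBound Cost) (ℓ , ℓ-bound)
                                    (totalCompletionTime S , λ b b-bound → b-bound _ (S , refl))
      in opt , <-≤-trans 0<ℓ (upper ℓ ℓ-bound) ,
         (λ v v-cost → least v λ b b-bound → b-bound v v-cost) , upper

    -- Any schedule `S` bounds the optimum from above, so comparing with `S` can only understate the
    -- ratio total / opt, and the optimum itself never has to be computed.
    competitiveRatio≥ : ∀ (A : Algorithm) (S : Schedule M J) {x} → 0# ≤ x →
      x * totalCompletionTime S ≤ totalCompletionTime (A M J) → CompetitiveRatioAtLeast A n x
    competitiveRatio≥ A S {x} 0≤x x*cost≤ b b-bound =
      let opt , 0<opt , isOpt = optimumExists (A M J)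
          r , 0<r , opt*r≈1   = positiveInverse 0<opt
          total               = totalCompletionTime (A M J)
          q*opt≈total : total * r * opt ≈ total
          q*opt≈total = begin-equality
            total * r * opt    ≈⟨ *-assoc total r opt ⟩
            total * (r * opt)  ≈⟨ *-congˡ (*-comm r opt) ⟩
            total * (opt * r)  ≈⟨ *-congˡ opt*r≈1 ⟩
            total * 1#         ≈⟨ *-identityʳ total ⟩
            total              ∎
      in ≤-trans
        (*-cancelˡ-≤ 0<opt (begin
          opt * x                       ≈⟨ *-comm opt x ⟩
          x * opt                       ≤⟨ *-monoʳ-≤ 0≤x (proj₁ isOpt _ (S , refl)) ⟩
          x * totalCompletionTime S     ≤⟨ x*cost≤ ⟩
          total                         ≈⟨ q*opt≈total ⟨
          total * r * opt               ≈⟨ *-comm (total * r) opt ⟩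
          opt * (total * r)             ∎))
        (b-bound (total * r) (M , J , opt , isOpt , q*opt≈total))

  -- Schedules in which every job has a machine of its own

  module Parallel {n : ℕ} (M : Machines) (J : Jobs n)
    (μ : Fin n → Fin (m M)) (μ-injective : ∀ {j k} → μ j ≡ μ k → j ≡ k)
    (D : Fin n → Time) (0≤D : ∀ j → 0# ≤ D j) (speed*D≈p : ∀ j → speed M (μ j) * D j ≈ p J j) where

    0≤s : ∀ j → 0# ≤ speed M (μ j)
    0≤s j = proj₁ (speed>0 M (μ j))

    -- The decision is an argument so that proofs about `parallelRun` can split on it directly.
    assigned : ∀ {i} → Dec (∃ λ j → μ j ≡ i) → Time → Maybe (Fin n)
    assigned (yes (j , _)) t = if does (t ≤? D j) then just j else nothing
    assigned (no _)        t = nothing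

    parallelRun : Time → Fin (m M) → Maybe (Fin n)
    parallelRun t i = assigned (Fin.any? λ j → μ j Fin.≟ i) t

    parallelRun-sound : ∀ {t i j} → parallelRun t i ≡ just j → μ j ≡ i × t ≤ D j
    parallelRun-sound {t} {i} {j} = sound (Fin.any? λ j → μ j Fin.≟ i)
      where
      sound : (d : Dec (∃ λ j → μ j ≡ i)) → assigned d t ≡ just j → μ j ≡ i × t ≤ D j
      sound (yes (k , μk≡i)) eq with t ≤? D k
      sound (yes (k , μk≡i)) ≡.refl | yes t≤D = μk≡i , t≤D

    parallelRun-complete : ∀ {t j} → t ≤ D j → parallelRun t (μ j) ≡ just j
    parallelRun-complete {t} {j} t≤D = complete′ (Fin.any? λ k → μ k Fin.≟ μ j)
      where
      complete′ : (d : Dec (∃ λ k → μ k ≡ μ j)) → assigned d t ≡ just j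
      complete′ (no ¬found) = contradiction (j , ≡.refl) ¬found
      -- The search returns some job placed on machine `μ j`; injectivity identifies it with j.
      complete′ (yes (k , μk≡μj)) with ≡.refl ← μ-injective μk≡μj
        rewrite dec-true (t ≤? D j) t≤D = ≡.refl

    parallelRun-cong : ∀ {t u} → t ≈ u → ∀ i → parallelRun t i ≡ parallelRun u i
    parallelRun-cong {t} {u} t≈u i = congruent (Fin.any? λ j → μ j Fin.≟ i)
      where
      congruent : (d : Dec (∃ λ j → μ j ≡ i)) → assigned d t ≡ assigned d u
      congruent (no _)        = ≡.refl
      congruent (yes (j , _)) = ≡.cong (λ b → if b then just j else nothing)
        (does-⇔ (mk⇔ (≤-respˡ-≈ t≈u) (≤-respˡ-≈ (sym t≈u))) (t ≤? D j) (u ≤? D j))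

    parallelRate : ∀ j t → rateOf M (parallelRun t) j ≈ Cutoff.cutoff (speed M (μ j)) (D j) (speed>0 M (μ j)) t
    parallelRate j t = trans
      (rateOf-single M (parallelRun t) j (μ j) λ i runs → ≡.sym (proj₁ (parallelRun-sound runs)))
      (onMachine (t ≤? D j))
      where
      open Cutoff (speed M (μ j)) (D j) (speed>0 M (μ j))
      onMachine : Dec (t ≤ D j) → share (parallelRun t (μ j)) j (speed M (μ j)) ≈ cutoff t
      onMachine (yes t≤D) = reflexive (≡.trans
        (share-hit (speed M (μ j)) (parallelRun-complete t≤D)) (≡.sym (cutoff-before t≤D)))
      onMachine (no t≰D)  = reflexive (≡.trans
        (share-miss (speed M (μ j)) λ runs → t≰D (proj₂ (parallelRun-sound {t} runs)))
        (≡.sym (cutoff-after (≰⇒> t≰D))))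

    parallel : Schedule M J
    parallel = record
      { run              = parallelRun
      ; run-cong         = parallelRun-cong
      ; oneMachinePerJob = λ t _ j i i′ runs runs′ →
          ≡.trans (≡.sym (proj₁ (parallelRun-sound runs))) (proj₁ (parallelRun-sound runs′))
      ; work             = λ j t → speed M (μ j) * (t ⊓ D j)
      ; work-integral    = λ j t _ → integral-cong (λ u _ → sym (parallelRate j u))
          (Cutoff.integral-cutoff (speed M (μ j)) (D j) (speed>0 M (μ j)) (0≤D j))
      ; C                = D
      ; C≥0              = 0≤D
      ; C-done           = λ j → ≤-reflexive (trans (sym (speed*D≈p j))
          (*-congˡ (sym (x≤y⇒x⊓y≈x (≤-refl {D j})))))
      ; C-first          = λ j t _ p≤work → ≤-trans
          (*-cancelˡ-≤ (speed>0 M (μ j)) (≤-respˡ-≈ (sym (speed*D≈p j)) p≤work)) (x⊓y≤x t (D j))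
      ; run-stop         = λ t _ i j runs → proj₂ (parallelRun-sound runs)
      }

  -- Non-clairvoyance: the first completion at which two runs differ

  findMinimal : ∀ {n} (P : Fin n → Set) (κ : Fin n → Carrier) →
    (∀ k → ¬ P k) ⊎ ∃ λ k → P k × ∀ l → P l → κ k ≤ κ l
  findMinimal {zero}  P κ = inj₁ λ ()
  findMinimal {suc n} P κ with findMinimal (P ∘ suc) (κ ∘ suc) | em {P zero}
  ... | inj₁ none            | no ¬Pz = inj₁ λ { zero → ¬Pz ; (suc k) → none k }
  ... | inj₁ none            | yes Pz = inj₂ (zero , Pz , λ
        { zero _ → ≤-refl ; (suc l) Pl → contradiction Pl (none l) })
  ... | inj₂ (k , Pk , min)  | no ¬Pz = inj₂ (suc k , Pk , λ
        { zero Pz → contradiction Pz ¬Pz ; (suc l) Pl → min l Pl })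
  ... | inj₂ (k , Pk , min)  | yes Pz with ≤-total (κ zero) (κ (suc k))
  ...   | inj₁ z≤k = inj₂ (zero , Pz , λ { zero _ → ≤-refl ; (suc l) Pl → ≤-trans z≤k (min l Pl) })
  ...   | inj₂ k≤z = inj₂ (suc k , Pk , λ { zero _ → k≤z ; (suc l) Pl → min l Pl })

  -- A difference at τ itself is allowed, so consequences for the runs hold only strictly before τ.
  -- Both completions are bounded so that the relation can be used in either direction.
  AgreeBefore : ∀ {n M} {J J′ : Jobs n} → Time → Schedule M J → Schedule M J′ → Set
  AgreeBefore τ S S′ = ∀ l → ¬ C S l ≈ C S′ l → τ ≤ C S l × τ ≤ C S′ l

  agree-sym : ∀ {n M τ} {J J′ : Jobs n} (S : Schedule M J) (S′ : Schedule M J′) →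
    AgreeBefore τ S S′ → AgreeBefore τ S′ S
  agree-sym S S′ agree l differ = let τ≤C , τ≤C′ = agree l (differ ∘ sym) in τ≤C′ , τ≤C

  -- A completion at v ≤ u < τ is too early to be one of those that differ.
  agree⇒sameCompletions : ∀ {n M τ u} {J J′ : Jobs n} (S : Schedule M J) (S′ : Schedule M J′) →
    AgreeBefore τ S S′ → u < τ → SameCompletionsUpTo u S S′
  agree⇒sameCompletions {τ = τ} {u} S S′ agree u<τ j v v≤u = mk⇔
    (λ C≈v  → trans (sym (same (λ l≉ → proj₁ (agree j l≉)) C≈v)) C≈v)
    (λ C′≈v → trans (same (λ l≉ → proj₂ (agree j l≉)) C′≈v) C′≈v)
    where
    same : ∀ {c} → (¬ C S j ≈ C S′ j → τ ≤ c) → c ≈ v → C S j ≈ C S′ j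
    same τ≤c c≈v with em {C S j ≈ C S′ j}
    ... | yes eq = eq
    ... | no differ = contradiction (≤-trans (≤-respʳ-≈ c≈v (τ≤c differ)) v≤u) (<⇒≱ u<τ)

  module _ {A : Algorithm} (nonClairvoyant : NonClairvoyant A) {n : ℕ} (M : Machines) where

    sameRun : ∀ {J J′ : Jobs n} {τ u} → AgreeBefore τ (A M J) (A M J′) → 0# ≤ u → u < τ →
      ∀ i → run (A M J) u i ≡ run (A M J′) u i
    sameRun {J} {J′} agree 0≤u u<τ =
      nonClairvoyant M J J′ _ 0≤u (agree⇒sameCompletions (A M J) (A M J′) agree u<τ)

    -- The runs may part at τ, but a single instant does not affect the integral up to τ.
    sameWork : ∀ {J J′ : Jobs n} {τ} → AgreeBefore τ (A M J) (A M J′) → 0# ≤ τ →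
      ∀ l → work (A M J) l τ ≈ work (A M J′) l τ
    sameWork {J} {J′} {τ} agree 0≤τ l = integral-unique 0≤τ
      (λ u 0≤u u<τ → rateOf-cong M (sameRun {J} {J′} agree 0≤u u<τ) l)
      (work-integral (A M J) l τ 0≤τ) (work-integral (A M J′) l τ 0≤τ)

    -- When k completes for `J`, it has received the same work for `J′`, and this already covers the
    -- size that `J′` asks for.
    notLater : ∀ {J J′ : Jobs n} k → AgreeBefore (C (A M J) k) (A M J) (A M J′) →
      p J′ k ≤ p J k → C (A M J′) k ≤ C (A M J) k
    notLater {J} {J′} k agree p′≤p = C-first (A M J′) k (C (A M J) k) (C≥0 (A M J) k)
      (≤-trans p′≤p (≤-respʳ-≈ (sameWork {J} {J′} agree (C≥0 (A M J) k) k) (C-done (A M J) k)))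

    -- At the first completion on which the two schedules differ, equal work
    -- has been done on all jobs; hence it is the completion of j for J.
    lengthening : ∀ {J J′ : Jobs n} j → (∀ k → k ≢ j → p J k ≈ p J′ k) → p J j ≤ p J′ j →
      AgreeBefore (C (A M J) j) (A M J) (A M J′)
    lengthening {J} {J′} j p≈p′ pj≤p′j = byFirst (findMinimal
        (λ k → ¬ C (A M J) k ≈ C (A M J′) k) (λ k → C (A M J) k ⊓ C (A M J′) k))
      where
      p≤p′ : ∀ k → p J k ≤ p J′ k
      p≤p′ k with k Fin.≟ j
      ... | yes ≡.refl = pj≤p′j
      ... | no  k≢j    = ≤-reflexive (p≈p′ k k≢j)

      byFirst : ((∀ k → ¬ ¬ C (A M J) k ≈ C (A M J′) k) ⊎
          ∃ λ k → (¬ C (A M J) k ≈ C (A M J′) k) × ∀ l → ¬ C (A M J) l ≈ C (A M J′) l →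
            C (A M J) k ⊓ C (A M J′) k ≤ C (A M J) l ⊓ C (A M J′) l) →
        AgreeBefore (C (A M J) j) (A M J) (A M J′)
      byFirst (inj₁ same) = λ l differ → contradiction differ (same l)
      byFirst (inj₂ (k , k≉ , minimal)) = byOrder (≤-total (C (A M J) k) (C (A M J′) k))
        where
        agree : ∀ {τ} → C (A M J) k ⊓ C (A M J′) k ≈ τ → AgreeBefore τ (A M J) (A M J′)
        agree eq l l≉ = ≤-trans τ≤ (x⊓y≤x _ _) , ≤-trans τ≤ (x⊓y≤y _ _)
          where τ≤ = ≤-respˡ-≈ eq (minimal l l≉)

        byOrder : C (A M J) k ≤ C (A M J′) k ⊎ C (A M J′) k ≤ C (A M J) k →
          AgreeBefore (C (A M J) j) (A M J) (A M J′)
        -- If `J′` came first at the earliest difference, then k, being no larger in `J`, would be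
        -- complete there by the same time.
        byOrder (inj₂ C′≤C) = contradiction (≤-antisym
          (notLater {J′} {J} k
            (agree-sym (A M J) (A M J′) (agree (x≤y⇒y⊓x≈x C′≤C))) (p≤p′ k)) C′≤C) k≉
        byOrder (inj₁ C≤C′) with k Fin.≟ j
        ... | yes ≡.refl = agree (x≤y⇒x⊓y≈x C≤C′)
        -- A job other than j has equal sizes in both instances, so equal work completes it in both
        -- at once.
        ... | no  k≢j    = contradiction (≤-antisym C≤C′
          (notLater {J} {J′} k (agree (x≤y⇒x⊓y≈x C≤C′)) (≤-reflexive (sym (p≈p′ k k≢j))))) k≉

  -- The adversarial instances

  updateAt-elim : ∀ {B : Set} {n} (P : Fin n → B → Set) {xs : Fin n → B} {x} j →
    P j x → (∀ l → l ≢ j → P l (xs l)) → ∀ l → P l (updateAt xs j (const x) l)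
  updateAt-elim P {xs} j Pj Pl l with l Fin.≟ j
  ... | yes ≡.refl = ≡.subst (P l) (≡.sym (updateAt-updates l xs)) Pj
  ... | no  l≢j    = ≡.subst (P l) (≡.sym (updateAt-minimal l j xs l≢j)) (Pl l l≢j)

  -- The old entry at j is kept in the bound. In the application this merely replaces N + (N - 1) by
  -- N + N.
  sum-updateAt≤ : ∀ {B : Set} {n} (f : B → Carrier) (xs : Fin n → B) {x} j → 0# ≤ f (xs j) →
    sum (f ∘ updateAt xs j (const x)) ≤ f x + sum (f ∘ xs)
  sum-updateAt≤ f xs {x} zero 0≤fx₀ =
    +-mono-≤ ≤-refl (≤-respʳ-≈ (+-comm _ (f (xs zero))) (x≤x+y 0≤fx₀))
  sum-updateAt≤ f xs {x} (suc j) 0≤fxⱼ = begin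
    f (xs zero) + sum (f ∘ updateAt (xs ∘ suc) j (const x))
      ≤⟨ +-mono-≤ ≤-refl (sum-updateAt≤ f (xs ∘ suc) j 0≤fxⱼ) ⟩
    f (xs zero) + (f x + sum (f ∘ xs ∘ suc))
      ≈⟨ solve 3 (λ a b c → a :+ (b :+ c) := b :+ (a :+ c)) refl (f (xs zero)) (f x) _ ⟩
    f x + (f (xs zero) + sum (f ∘ xs ∘ suc)) ∎

  0≤fromℕ : ∀ n → 0# ≤ fromℕ n
  0≤fromℕ zero    = ≤-refl
  0≤fromℕ (suc n) = +-nonNegative 0≤1 (0≤fromℕ n)

  -- Bundling the three values lets one `updateAt` change the machine, completion time and size of
  -- the long job together, so each property of the plan follows by one elimination.
  record Placement (m : ℕ) : Set where
    constructor place
    field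
      machine         : Fin m
      completion size : Carrier

  open Placement

  module Adversary {A : Algorithm} (nonMigratory : NonMigratory A) (nonClairvoyant : NonClairvoyant A)
    (k : ℕ) (s : Carrier) (0≤s : 0# ≤ s) (s*s≈n : s * s ≈ fromℕ (suc k))
    (h : Carrier) (0<h : 0# < h) (h+h≈1 : h + h ≈ 1#) where

    n : ℕ
    n = suc k

    N : Carrier
    N = fromℕ n

    1≤N : 1# ≤ N
    1≤N = x≤x+y (0≤fromℕ k)

    0<N : 0# < N
    0<N = <-≤-trans 0<1 1≤N

    1≤s : 1# ≤ s
    1≤s with ≤-total 1# s
    ... | inj₁ 1≤s = 1≤s
    ... | inj₂ s≤1 = begin
      1#      ≤⟨ 1≤N ⟩
      N       ≈⟨ s*s≈n ⟨
      s * s   ≤⟨ *-monoʳ-≤ 0≤s s≤1 ⟩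
      s * 1#  ≈⟨ *-identityʳ s ⟩
      s       ∎

    0<s : 0# < s
    0<s = <-≤-trans 0<1 1≤s

    0≤ratio : 0# ≤ h * h * s
    0≤ratio = *-nonNegative (*-nonNegative (proj₁ 0<h) (proj₁ 0<h)) 0≤s

    sum-ones : sum {n} (const 1#) ≈ N
    sum-ones = trans (sum-const n 1#) (*-identityʳ N)

    machines : Machines
    machines = record
      { m       = suc n
      ; speed   = λ { zero → s ; (suc _) → 1# }
      ; speed>0 = λ { zero → 0<s ; (suc _) → 0<1 }
      }

    unitJobs : Jobs n
    unitJobs = record { p = const 1# ; p>0 = const 0<1 }

    onSlowMachines : Schedule machines unitJobs
    onSlowMachines = Parallel.parallel machines unitJobs suc Fin.suc-injective
      (const 1#) (const 0≤1) (const (*-identityˡ 1#))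

    S : Schedule machines unitJobs
    S = A machines unitJobs

    module OneLongJob (j : Fin n) {u} (0≤u : 0# ≤ u) (u<C : u < C S j)
      {i} (runs : run S u (suc i) ≡ just j) where

      short : Fin n → Placement (suc n)
      short l = place (suc l) 1# 1#

      -- The long size s N takes time N on the fast machine, no more than the order of the total for
      -- the short jobs, but time s N on a slow one.
      plan : Fin n → Placement (suc n)
      plan = updateAt short j (const (place zero N (s * N)))

      plan-elim : (P : Fin n → Placement (suc n) → Set) →
        P j (place zero N (s * N)) → (∀ l → P l (short l)) → ∀ l → P l (plan l)
      plan-elim P Pj Pl = updateAt-elim P j Pj (λ l _ → Pl l)

      longJobs : Jobs n
      longJobs = record
        { p   = size ∘ plan
        ; p>0 = plan-elim (λ _ x → 0# < size x) (*-positive 0<s 0<N) (λ _ → 0<1)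
        }

      1≤s*N : 1# ≤ s * N
      1≤s*N = begin
        1#      ≤⟨ 1≤s ⟩
        s       ≈⟨ *-identityʳ s ⟨
        s * 1#  ≤⟨ *-monoʳ-≤ 0≤s 1≤N ⟩
        s * N   ∎

      pⱼ≡s*N : p longJobs j ≡ s * N
      pⱼ≡s*N = ≡.cong size (updateAt-updates j short)

      S′ : Schedule machines longJobs
      S′ = A machines longJobs

      runs′ : run S′ u (suc i) ≡ just j
      runs′ = ≡.trans (≡.sym (sameRun {A} nonClairvoyant machines {unitJobs} {longJobs}
        (lengthening {A} nonClairvoyant machines {unitJobs} {longJobs} j
          (λ l l≢j → reflexive (≡.sym (≡.cong size (updateAt-minimal l j short l≢j))))
          (≤-respʳ-≈ (reflexive (≡.sym pⱼ≡s*N)) 1≤s*N))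
        0≤u u<C (suc i))) runs

      -- By `runs′`, j is on a slow machine at time u in the lengthened instance as well;
      -- non-migration then pins it there at all times, so its rate never exceeds 1.
      s*N≤cost : s * N ≤ totalCompletionTime S′
      s*N≤cost = begin
        s * N                      ≡⟨ pⱼ≡s*N ⟨
        p longJobs j               ≤⟨ p≤speed*C S′ j 1# (λ v 0≤v _ → rateOf≤speed machines (run S′ v) j (suc i)
                                        λ i′ eq → nonMigratory machines longJobs j v u i′ (suc i) 0≤v 0≤u eq runs′) ⟩
        1# * C S′ j                ≈⟨ *-identityˡ _ ⟩
        C S′ j                     ≤⟨ term≤sum (C≥0 S′) j ⟩
        totalCompletionTime S′     ∎

      -- A left inverse of `machine ∘ plan`, which yields the injectivity that `Parallel` asks for.
      jobOn : Fin (suc n) → Fin n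
      jobOn zero    = j
      jobOn (suc l) = l

      jobOn-machine : ∀ l → jobOn (machine (plan l)) ≡ l
      jobOn-machine = plan-elim (λ l x → jobOn (machine x) ≡ l) ≡.refl (λ _ → ≡.refl)

      longOnFast : Schedule machines longJobs
      longOnFast = Parallel.parallel machines longJobs (machine ∘ plan)
        (λ {l} {l′} eq → ≡.trans (≡.sym (jobOn-machine l)) (≡.trans (≡.cong jobOn eq) (jobOn-machine l′)))
        (completion ∘ plan)
        (plan-elim (λ _ x → 0# ≤ completion x) (proj₁ 0<N) (λ _ → 0≤1))
        (plan-elim (λ _ x → speed machines (machine x) * completion x ≈ size x)
          refl (λ _ → *-identityˡ 1#))

      competitiveRatio : CompetitiveRatioAtLeast A n (h * h * s)
      competitiveRatio = competitiveRatio≥ machines longJobs j A longOnFast 0≤ratio (begin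
        h * h * s * totalCompletionTime longOnFast
          ≤⟨ *-monoʳ-≤ 0≤ratio (sum-updateAt≤ completion short j 0≤1) ⟩
        h * h * s * (N + sum {n} (const 1#))  ≈⟨ *-congˡ (+-congˡ sum-ones) ⟩
        h * h * s * (N + N)
          ≈⟨ solve 3 (λ h s N → h :* h :* s :* (N :+ N) := (h :+ h) :* h :* (s :* N)) refl h s N ⟩
        (h + h) * h * (s * N)                 ≈⟨ *-congʳ (*-congʳ h+h≈1) ⟩
        1# * h * (s * N)                      ≈⟨ *-congʳ (*-identityˡ h) ⟩
        -- A factor of 2 is given away: this case alone would support the constant `h` in place of
        -- `h * h`.
        h * (s * N)                           ≤⟨ *-monoˡ-≤ (proj₁ (*-positive 0<s 0<N)) (≤-respʳ-≈ h+h≈1 (x≤x+y (proj₁ 0<h))) ⟩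
        1# * (s * N)                          ≈⟨ *-identityˡ _ ⟩
        s * N                                 ≤⟨ s*N≤cost ⟩
        totalCompletionTime S′                ∎)

    module AllOnFast (fastOnly : ∀ j t i → 0# ≤ t → run S t i ≡ just j → i ≡ zero) where

      -- T = n / (2 s), so that by time T at most half of the n units of work is done.
      T : Time
      T = s * h

      0≤T : 0# ≤ T
      0≤T = *-nonNegative 0≤s (proj₁ 0<h)

      W : Carrier
      W = sum λ j → work S j T

      W≤s*T : W ≤ s * T
      W≤s*T = totalWork≤ S s 0≤T λ u 0≤u _ →
        totalRate≤speed machines (run S u) zero λ j i → fastOnly j u i 0≤u

      -- A job still open at T pays with C ≥ T, a finished one with its unit of work. Being linear
      -- in the work, the bound can be summed without counting unfinished jobs.
      T≤C+T*work : ∀ j → T ≤ C S j + T * work S j T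
      T≤C+T*work j with ≤-total (C S j) T
      ... | inj₂ T≤C = ≤-trans T≤C (x≤x+y (*-nonNegative 0≤T (work-nonNegative S j 0≤T)))
      ... | inj₁ C≤T = begin
        T                           ≈⟨ *-identityʳ T ⟨
        T * 1#                      ≤⟨ *-monoʳ-≤ 0≤T (completed S j C≤T) ⟩
        T * work S j T              ≤⟨ x≤x+y (C≥0 S j) ⟩
        T * work S j T + C S j      ≈⟨ +-comm _ _ ⟩
        C S j + T * work S j T      ∎

      -- Since s T = h N, the cost is left with at least (1 - h) N T = h N T, which is h h s N.
      N*T≤cost+T*[s*T] : N * T ≤ totalCompletionTime S + T * (s * T)
      N*T≤cost+T*[s*T] = begin
        N * T                                          ≈⟨ sum-const n T ⟨
        sum {n} (const T)                              ≤⟨ sum-mono-≤ T≤C+T*work ⟩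
        sum (λ j → C S j + T * work S j T)             ≈⟨ ∑-distrib-+ (C S) (λ j → T * work S j T) ⟩
        totalCompletionTime S + sum (λ j → T * work S j T)
          ≈⟨ +-congˡ (*-distribˡ-sum T (λ j → work S j T)) ⟨
        totalCompletionTime S + T * W                  ≤⟨ +-mono-≤ ≤-refl (*-monoʳ-≤ 0≤T W≤s*T) ⟩
        totalCompletionTime S + T * (s * T)            ∎

      competitiveRatio : CompetitiveRatioAtLeast A n (h * h * s)
      competitiveRatio = competitiveRatio≥ machines unitJobs zero A onSlowMachines 0≤ratio
        -- Writing N T as (h + h) N T splits it into two equal parts: s s = N turns one into T (s
        -- T), and the other is the claimed bound.
        (≤-transfer N*T≤cost+T*[s*T] (begin-equality
          N * (s * h) + cost                          ≈⟨ +-congʳ (*-identityˡ _) ⟨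
          1# * (N * (s * h)) + cost                   ≈⟨ +-congʳ (*-congʳ h+h≈1) ⟨
          (h + h) * (N * (s * h)) + cost
            ≈⟨ solve 4 (λ h s N c → (h :+ h) :* (N :* (s :* h)) :+ c
                 := c :+ s :* h :* h :* N :+ h :* h :* s :* N) refl h s N cost ⟩
          cost + s * h * h * N + h * h * s * N        ≈⟨ +-cong (+-congˡ (*-congˡ (sym s*s≈n))) (*-congˡ (sym sum-ones)) ⟩
          cost + s * h * h * (s * s) + h * h * s * sum {n} (const 1#)
            ≈⟨ +-congʳ (+-congˡ (solve 2 (λ h s → s :* h :* h :* (s :* s) := s :* h :* (s :* (s :* h))) refl h s)) ⟩
          cost + T * (s * T) + h * h * s * sum {n} (const 1#) ∎))
        where cost = totalCompletionTime S

    competitiveRatio : CompetitiveRatioAtLeast A n (h * h * s)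
    competitiveRatio with em {∃ λ j → ∃ λ u → 0# ≤ u × u < C S j × ∃ λ i → run S u (suc i) ≡ just j}
    ... | yes (j , u , 0≤u , u<C , i , runs) = OneLongJob.competitiveRatio j 0≤u u<C runs
    ... | no  ¬slow = AllOnFast.competitiveRatio fastOnly
      where
      -- Each job runs somewhere strictly before it completes, and in this case that must be on the
      -- fast machine; non-migration carries this over to every t, including the instant of
      -- completion.
      fastOnly : ∀ j t i → 0# ≤ t → run S t i ≡ just j → i ≡ zero
      fastOnly j t i 0≤t eq with runsBeforeCompletion S j
      ... | u , 0≤u , u<C , zero  , runs = nonMigratory machines unitJobs j t u i zero 0≤t 0≤u eq runs
      ... | u , 0≤u , u<C , suc i′ , runs = contradiction (j , u , 0≤u , u<C , i′ , runs) ¬slow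

theorem6 : ExcludedMiddle 0ℓ → (ℝ : RealNumbers) →
    let open RealNumbers ℝ
        open Scheduling ℝ
    in ∃ λ (c : Carrier) → 0# < c × ∃ λ (n₀ : ℕ) →
       ∀ (A : Algorithm) → NonMigratory A → NonClairvoyant A →
       ∀ (n : ℕ) → n₀ ≤ℕ n →
       ∀ (√n : Carrier) → IsSqrt (fromℕ n) √n →
       CompetitiveRatioAtLeast A n (c * √n)
theorem6 em ℝ =
  let open RealNumbers ℝ using (_*_)
      open OrderedField em ℝ using (half; *-positive)
      h , 0<h , h+h≈1 = half
  -- The constant is 1/4. The threshold 1 ensures N ≥ 1 and thereby s ≥ 1, so that s N is indeed at
  -- least the unit size.
  in h * h , *-positive 0<h 0<h , 1 , λ where
    A nonMigratory nonClairvoyant (suc k) _ √n (0≤√n , √n*√n≈n) →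
      Schedules.Adversary.competitiveRatio em ℝ {A} nonMigratory nonClairvoyant k √n 0≤√n √n*√n≈n h 0<h h+h≈1
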